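{- Let $\mathbf a=[-1,-1,-1,-1,1,-1,-1,-1,1,1,-1,1,-1,1,-1,1,1,-1,-1,1,1,-1,-1,1,-1,1,-1,1,1,$ $-1,-1,1,1,1,-1,-1,-1,-1,-1,1,-1,-1,1,-1,-1,-1,1,1,1,1,-1,-1,-1,1,-1,1,1,$ $1,-1,1,1,-1,-1,-1,-1,1,1,1,1,1,1,-1,-1,1,1,1,-1,1,1,1,1,1,-1,1,-1,1,-1],$ $\mathbf b=[-1,-1,-1,-1,-1,-1,-1,-1,1,1,1,1,-1,1,1,-1,1,1,-1,1,-1,1,1,1,1,-1,-1,1,1,$ $-1,1,1,-1,1,-1,-1,1,-1,-1,1,1,1,-1,1,-1,1,1,-1,-1,1,-1,-1,1,1,1,1,1,-1,-1,$ $-1,1,1,1,-1,-1,1,-1,1,-1,-1,1,-1,1,-1,-1,-1,1,-1,-1,1,1,1,-1,1,-1,1,-1],$ $\mathbf a'=[-1,-1,-1,-1,1,-1,-1,-1,1,1,1,1,1,1,-1,1,-1,-1,-1,1,1,1,-1,1,-1,-1,-1,1,$ $1,-1,-1,1,1,1,-1,-1,-1,1,-1,-1,1,-1,1,-1,-1,1,1,1,1,1,-1,-1,1,1,1,-1,1,1,-1,$ $1,1,-1,-1,-1,-1,1,-1,1,1,-1,-1,-1,-1,1,1,1,-1,1,1,-1,1,-1,-1,1,1,1,-1],$ $\mathbf b'=[-1,1,-1,1,1,-1,-1,1,1,1,1,1,1,-1,1,-1,1,1,1,-1,-1,1,-1,1,-1,1,-1,1,-1,$ $-1,-1,1,-1,-1,-1,-1,-1,-1,-1,1,-1,1,1,1,-1,1,-1,-1,1,-1,-1,1,1,1,-1,-1,$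 $1,1,-1,-1,1,-1,1,-1,-1,1,-1,1,-1,1,-1,-1,1,-1,-1,1,-1,-1,1,1,1,1,1,1,1,1,-1].$ Then $(\mathbf a,\mathbf b)$ and $(\mathbf a',\mathbf b')$ are Legendre pairs of length $87$. Moreover both $\mathbf a$ and $\mathbf a'$ have $3$-compression $$[-3,-1,1,-1,1,-3,-3,-1,1,1,1,1,-1,1,-3,1,1,1,-1,3,3,-1,-1,1,-1,1,-1,3,1],$$ and both $\mathbf b$ and $\mathbf b'$ have $3$-compression $$[-3,-1,1,-1,1,-3,-3,1,-1,1,1,1,1,-1,3,-3,1,1,-1,-1,-1,1,1,3,1,1,-1,3,-1],$$ so that each $3$-compression has exactly seven entries of absolute value $3$. In particular, a Legendre pair of length $87$ exists.
   Context: Vectors of length $\ell$ are indexed by $\mathbb{Z}_\ell=\{0,\ldots,\ell-1\}$. For $\mathbf a\in\mathbb{R}^\ell$, the periodic autocorrelation function is $\mathrm{PAF}_{\mathbf a}(j)=\sum_{i=0}^{\ell-1}a_i a_{i-j}$ (indices mod $\ell$). A pair $(\mathbf a,\mathbf b)$ of vectors in $\{ -1,1\}^\ell$ is a Legendre pair of length $\ell$ if $\mathrm{PAF}_{\mathbf a}(j)+\mathrm{PAF}_{\mathbf b}(j)=-2$ for all $j\in\mathbb{Z}_\ell\setminus\{0\}$ and $\sum_i a_i=\sum_i b_i$. For $\ell=nm$, the $m$-compression of $\mathbf a$ is the length-$n$ vector $[A_0,\ldots,A_{n-1}]$ with $A_j=\sum_{i=0}^{m-1}a_{ni+j}$; here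 $\ell=87$, $m=3$, $n=29$. -}

module Defs where

open import Data.Fin using (Fin; toℕ; combine)
open import Data.Fin.Properties using (nonZeroIndex)
open import Data.Integer using (ℤ; +_; -_; _+_; _*_; ∣_∣; -1ℤ; 1ℤ)
open import Data.Integer.Properties using (+-0-commutativeMonoid)
open import Data.Nat as ℕ using (ℕ; _∸_)
open import Data.Nat.DivMod using (_mod_)
open import Data.Sum using (_⊎_)
open import Data.Vec using (Vec; []; _∷_; lookup; tabulate; count)
open import Data.Vec.Relation.Unary.All using (All)
open import Relation.Binary.PropositionalEquality using (_≡_; _≢_)

open import Algebra.Properties.CommutativeMonoid.Sum +-0-commutativeMonoid using (sum-syntax)

private variable
  ℓ : ℕ

-- Subtraction in ℤ_ℓ, with Fin ℓ as the residues 0, …, ℓ-1; ℓ is added before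
-- reduction because subtraction on ℕ truncates.
infixl 6 _⊖_
_⊖_ : Fin ℓ → Fin ℓ → Fin ℓ
_⊖_ {ℓ} i j = _mod_ (toℕ i ℕ.+ (ℓ ∸ toℕ j)) ℓ ⦃ nonZeroIndex i ⦄

PAF : Vec ℤ ℓ → Fin ℓ → ℤ
PAF {ℓ} x j = ∑[ i < ℓ ] (lookup x i * lookup x (i ⊖ j))

record IsLegendrePair {ℓ : ℕ} (x y : Vec ℤ ℓ) : Set where
  field
    x-±1      : All (λ v → v ≡ -1ℤ ⊎ v ≡ 1ℤ) x
    y-±1      : All (λ v → v ≡ -1ℤ ⊎ v ≡ 1ℤ) y
    PAF-sum   : ∀ (j : Fin ℓ) → toℕ j ≢ 0 → PAF x j + PAF y j ≡ - (+ 2)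
    equal-sum : ∑[ i < ℓ ] lookup x i ≡ ∑[ i < ℓ ] lookup y i

-- combine i j is the index n i + j (Data.Fin.Properties.toℕ-combine).
compression : (m n : ℕ) → Vec ℤ (m ℕ.* n) → Vec ℤ n
compression m n x = tabulate λ (j : Fin n) → ∑[ i < m ] lookup x (combine i j)

#abs3 : Vec ℤ ℓ → ℕ
#abs3 = count (λ v → ∣ v ∣ ℕ.≟ 3)

3ℤ -3ℤ : ℤ
3ℤ  = + 3
-3ℤ = - (+ 3)

-- The data, 29 entries to a row, so that the 3-compression is the column sum.

a : Vec ℤ 87
a =
  -1ℤ ∷ -1ℤ ∷ -1ℤ ∷ -1ℤ ∷  1ℤ ∷ -1ℤ ∷ -1ℤ ∷ -1ℤ ∷  1ℤ ∷  1ℤ ∷ -1ℤ ∷  1ℤ ∷ -1ℤ ∷  1ℤ ∷ -1ℤ ∷  1ℤ ∷  1ℤ ∷ -1ℤ ∷ -1ℤ ∷  1ℤ ∷  1ℤ ∷ -1ℤ ∷ -1ℤ ∷  1ℤ ∷ -1ℤ ∷  1ℤ ∷ -1ℤ ∷  1ℤ ∷  1ℤ ∷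
  -1ℤ ∷ -1ℤ ∷  1ℤ ∷  1ℤ ∷  1ℤ ∷ -1ℤ ∷ -1ℤ ∷ -1ℤ ∷ -1ℤ ∷ -1ℤ ∷  1ℤ ∷ -1ℤ ∷ -1ℤ ∷  1ℤ ∷ -1ℤ ∷ -1ℤ ∷ -1ℤ ∷  1ℤ ∷  1ℤ ∷  1ℤ ∷  1ℤ ∷ -1ℤ ∷ -1ℤ ∷ -1ℤ ∷  1ℤ ∷ -1ℤ ∷  1ℤ ∷  1ℤ ∷  1ℤ ∷
  -1ℤ ∷  1ℤ ∷  1ℤ ∷ -1ℤ ∷ -1ℤ ∷ -1ℤ ∷ -1ℤ ∷  1ℤ ∷  1ℤ ∷  1ℤ ∷  1ℤ ∷  1ℤ ∷  1ℤ ∷ -1ℤ ∷ -1ℤ ∷  1ℤ ∷  1ℤ ∷  1ℤ ∷ -1ℤ ∷  1ℤ ∷  1ℤ ∷  1ℤ ∷  1ℤ ∷  1ℤ ∷ -1ℤ ∷  1ℤ ∷ -1ℤ ∷  1ℤ ∷ -1ℤ ∷ []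

b : Vec ℤ 87
b =
  -1ℤ ∷ -1ℤ ∷ -1ℤ ∷ -1ℤ ∷ -1ℤ ∷ -1ℤ ∷ -1ℤ ∷ -1ℤ ∷  1ℤ ∷  1ℤ ∷  1ℤ ∷  1ℤ ∷ -1ℤ ∷  1ℤ ∷  1ℤ ∷ -1ℤ ∷  1ℤ ∷  1ℤ ∷ -1ℤ ∷  1ℤ ∷ -1ℤ ∷  1ℤ ∷  1ℤ ∷  1ℤ ∷  1ℤ ∷ -1ℤ ∷ -1ℤ ∷  1ℤ ∷  1ℤ ∷
  -1ℤ ∷  1ℤ ∷  1ℤ ∷ -1ℤ ∷  1ℤ ∷ -1ℤ ∷ -1ℤ ∷  1ℤ ∷ -1ℤ ∷ -1ℤ ∷  1ℤ ∷  1ℤ ∷  1ℤ ∷ -1ℤ ∷  1ℤ ∷ -1ℤ ∷  1ℤ ∷  1ℤ ∷ -1ℤ ∷ -1ℤ ∷  1ℤ ∷ -1ℤ ∷ -1ℤ ∷  1ℤ ∷  1ℤ ∷  1ℤ ∷  1ℤ ∷  1ℤ ∷ -1ℤ ∷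
  -1ℤ ∷ -1ℤ ∷  1ℤ ∷  1ℤ ∷  1ℤ ∷ -1ℤ ∷ -1ℤ ∷  1ℤ ∷ -1ℤ ∷  1ℤ ∷ -1ℤ ∷ -1ℤ ∷  1ℤ ∷ -1ℤ ∷  1ℤ ∷ -1ℤ ∷ -1ℤ ∷ -1ℤ ∷  1ℤ ∷ -1ℤ ∷ -1ℤ ∷  1ℤ ∷  1ℤ ∷  1ℤ ∷ -1ℤ ∷  1ℤ ∷ -1ℤ ∷  1ℤ ∷ -1ℤ ∷ []

a′ : Vec ℤ 87
a′ =
  -1ℤ ∷ -1ℤ ∷ -1ℤ ∷ -1ℤ ∷  1ℤ ∷ -1ℤ ∷ -1ℤ ∷ -1ℤ ∷  1ℤ ∷  1ℤ ∷  1ℤ ∷  1ℤ ∷  1ℤ ∷  1ℤ ∷ -1ℤ ∷  1ℤ ∷ -1ℤ ∷ -1ℤ ∷ -1ℤ ∷  1ℤ ∷  1ℤ ∷  1ℤ ∷ -1ℤ ∷  1ℤ ∷ -1ℤ ∷ -1ℤ ∷ -1ℤ ∷  1ℤ ∷  1ℤ ∷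
  -1ℤ ∷ -1ℤ ∷  1ℤ ∷  1ℤ ∷  1ℤ ∷ -1ℤ ∷ -1ℤ ∷ -1ℤ ∷  1ℤ ∷ -1ℤ ∷ -1ℤ ∷  1ℤ ∷ -1ℤ ∷  1ℤ ∷ -1ℤ ∷ -1ℤ ∷  1ℤ ∷  1ℤ ∷  1ℤ ∷  1ℤ ∷  1ℤ ∷ -1ℤ ∷ -1ℤ ∷  1ℤ ∷  1ℤ ∷  1ℤ ∷ -1ℤ ∷  1ℤ ∷  1ℤ ∷
  -1ℤ ∷  1ℤ ∷  1ℤ ∷ -1ℤ ∷ -1ℤ ∷ -1ℤ ∷ -1ℤ ∷  1ℤ ∷ -1ℤ ∷  1ℤ ∷  1ℤ ∷ -1ℤ ∷ -1ℤ ∷ -1ℤ ∷ -1ℤ ∷  1ℤ ∷  1ℤ ∷  1ℤ ∷ -1ℤ ∷  1ℤ ∷  1ℤ ∷ -1ℤ ∷  1ℤ ∷ -1ℤ ∷ -1ℤ ∷  1ℤ ∷  1ℤ ∷  1ℤ ∷ -1ℤ ∷ []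

b′ : Vec ℤ 87
b′ =
  -1ℤ ∷  1ℤ ∷ -1ℤ ∷  1ℤ ∷  1ℤ ∷ -1ℤ ∷ -1ℤ ∷  1ℤ ∷  1ℤ ∷  1ℤ ∷  1ℤ ∷  1ℤ ∷  1ℤ ∷ -1ℤ ∷  1ℤ ∷ -1ℤ ∷  1ℤ ∷  1ℤ ∷  1ℤ ∷ -1ℤ ∷ -1ℤ ∷  1ℤ ∷ -1ℤ ∷  1ℤ ∷ -1ℤ ∷  1ℤ ∷ -1ℤ ∷  1ℤ ∷ -1ℤ ∷
  -1ℤ ∷ -1ℤ ∷  1ℤ ∷ -1ℤ ∷ -1ℤ ∷ -1ℤ ∷ -1ℤ ∷ -1ℤ ∷ -1ℤ ∷ -1ℤ ∷  1ℤ ∷ -1ℤ ∷  1ℤ ∷  1ℤ ∷  1ℤ ∷ -1ℤ ∷  1ℤ ∷ -1ℤ ∷ -1ℤ ∷  1ℤ ∷ -1ℤ ∷ -1ℤ ∷  1ℤ ∷  1ℤ ∷  1ℤ ∷ -1ℤ ∷ -1ℤ ∷  1ℤ ∷  1ℤ ∷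
  -1ℤ ∷ -1ℤ ∷  1ℤ ∷ -1ℤ ∷  1ℤ ∷ -1ℤ ∷ -1ℤ ∷  1ℤ ∷ -1ℤ ∷  1ℤ ∷ -1ℤ ∷  1ℤ ∷ -1ℤ ∷ -1ℤ ∷  1ℤ ∷ -1ℤ ∷ -1ℤ ∷  1ℤ ∷ -1ℤ ∷ -1ℤ ∷  1ℤ ∷  1ℤ ∷  1ℤ ∷  1ℤ ∷  1ℤ ∷  1ℤ ∷  1ℤ ∷  1ℤ ∷ -1ℤ ∷ []

A : Vec ℤ 29
A =
  -3ℤ ∷ -1ℤ ∷  1ℤ ∷ -1ℤ ∷  1ℤ ∷ -3ℤ ∷ -3ℤ ∷ -1ℤ ∷  1ℤ ∷  1ℤ ∷  1ℤ ∷  1ℤ ∷ -1ℤ ∷  1ℤ ∷ -3ℤ ∷  1ℤ ∷  1ℤ ∷  1ℤ ∷ -1ℤ ∷  3ℤ ∷  3ℤ ∷ -1ℤ ∷ -1ℤ ∷  1ℤ ∷ -1ℤ ∷  1ℤ ∷ -1ℤ ∷  3ℤ ∷  1ℤ ∷ []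

B : Vec ℤ 29
B =
  -3ℤ ∷ -1ℤ ∷  1ℤ ∷ -1ℤ ∷  1ℤ ∷ -3ℤ ∷ -3ℤ ∷  1ℤ ∷ -1ℤ ∷  1ℤ ∷  1ℤ ∷  1ℤ ∷  1ℤ ∷ -1ℤ ∷  3ℤ ∷ -3ℤ ∷  1ℤ ∷  1ℤ ∷ -1ℤ ∷ -1ℤ ∷ -1ℤ ∷  1ℤ ∷  1ℤ ∷  3ℤ ∷  1ℤ ∷  1ℤ ∷ -1ℤ ∷  3ℤ ∷ -1ℤ ∷ []

{-# OPTIONS --safe #-}
module Submission where

open import Data.Fin using (zero; suc)
open import Data.Fin.Properties using (all?)
open import Data.Integer using (ℤ; +_; -_; _+_; -1ℤ; 1ℤ; _≟_)
open import Data.Nat using (ℕ; suc)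
open import Data.Product using (_×_; _,_; ∃₂)
open import Data.Sum using (_⊎_)
open import Data.Vec using (Vec)
open import Data.Vec.Relation.Unary.All as All using (All)
open import Relation.Binary.PropositionalEquality using (_≡_; refl)
open import Relation.Nullary.Decidable using (Dec; from-yes; _⊎-dec_)
open import Relation.Nullary.Negation using (contradiction)
open import Defs

private variable
  ℓ : ℕ

±1? : (x : Vec ℤ ℓ) → Dec (All (λ v → v ≡ -1ℤ ⊎ v ≡ 1ℤ) x)
±1? = All.all? λ v → (v ≟ -1ℤ) ⊎-dec (v ≟ 1ℤ)

-- Ranging over `suc j` leaves out shift 0, where ±1 vectors of length 87 give 87 + 87 = 174 and not
-- -2.
PAF-sum? : (x y : Vec ℤ (suc ℓ)) →
           Dec (∀ j → PAF x (suc j) + PAF y (suc j) ≡ - (+ 2))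
PAF-sum? x y = all? λ j → PAF x (suc j) + PAF y (suc j) ≟ - (+ 2)

legendre-ab : IsLegendrePair a b
legendre-ab = record
  { x-±1      = from-yes (±1? a)
  ; y-±1      = from-yes (±1? b)
  ; PAF-sum   = λ where
      zero    0≢0 → contradiction refl 0≢0
      (suc j) _   → from-yes (PAF-sum? a b) j
  -- Both sums evaluate to 1.
  ; equal-sum = refl
  }

legendre-a′b′ : IsLegendrePair a′ b′
legendre-a′b′ = record
  { x-±1      = from-yes (±1? a′)
  ; y-±1      = from-yes (±1? b′)
  ; PAF-sum   = λ where
      zero    0≢0 → contradiction refl 0≢0
      (suc j) _   → from-yes (PAF-sum? a′ b′) j
  ; equal-sum = refl
  }

mainTheorem2 : (IsLegendrePair a b × IsLegendrePair a′ b′)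
    × (compression 3 29 a ≡ A × compression 3 29 a′ ≡ A)
    × (compression 3 29 b ≡ B × compression 3 29 b′ ≡ B)
    × (#abs3 (compression 3 29 a) ≡ 7 × #abs3 (compression 3 29 a′) ≡ 7)
    × (#abs3 (compression 3 29 b) ≡ 7 × #abs3 (compression 3 29 b′) ≡ 7)
    × (∃₂ λ (x y : Vec ℤ 87) → IsLegendrePair x y)
mainTheorem2 =
  (legendre-ab , legendre-a′b′) ,
  -- Column sums of the three rows of 29 entries, then the counts of ±3 among them, all by
  -- evaluation.
  (refl , refl) , (refl , refl) , (refl , refl) , (refl , refl) ,
  (a , b , legendre-ab)
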